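{- There exists a $4$-sparse $4$-cycle system of order $v$ if and only if $v\equiv 1 \pmod 8$.
   Context: A $4$-cycle is a cycle of length four, written $(a,b,c,d)$ with edges $\{a,b\},\{b,c\},\{c,d\},\{d,a\}$. A $4$-cycle system of order $v$, $4\mathrm{CS}(v)$, is a pair $(V,\mathcal{C})$ where $V$ is the vertex set of $K_v$ and $\mathcal{C}$ is a collection of edge-disjoint $4$-cycles whose edges partition the edge set of $K_v$. A $(k,l)$-configuration in a $4$CS is a set of $l$ of its $4$-cycles whose union contains precisely $k$ vertices. A $4$CS is $r$-sparse if it contains no $(j+3,j)$-configuration for any integer $j$ with $2\le j\le r$. -}

module Defs where

open import Data.Nat using (ℕ; _+_; _≤_)
open import Data.Fin using (Fin)
open import Data.Fin.Subset using (Subset; ⁅_⁆; _∪_; ⋃; ∣_∣)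
open import Data.List using (List; length; map; lookup)
open import Data.List.Relation.Unary.Unique.Propositional using (Unique)
open import Data.Product using (Σ; ∃; ∃!; _×_; _,_)
open import Data.Sum using (_⊎_)
open import Relation.Binary.PropositionalEquality using (_≡_; _≢_)
open import Relation.Nullary using (¬_)

record Cycle4 (v : ℕ) : Set where
  constructor cyc
  field
    a b c d : Fin v
    a≢b : a ≢ b
    a≢c : a ≢ c
    a≢d : a ≢ d
    b≢c : b ≢ c
    b≢d : b ≢ d
    c≢d : c ≢ d

open Cycle4 public

SameEdge : {v : ℕ} → Fin v → Fin v → Fin v → Fin v → Set
SameEdge x y p q = (x ≡ p × y ≡ q) ⊎ (x ≡ q × y ≡ p)

EdgeOf : {v : ℕ} → Fin v → Fin v → Cycle4 v → Set
EdgeOf x y C =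
  SameEdge x y (a C) (b C) ⊎ SameEdge x y (b C) (c C)
  ⊎ SameEdge x y (c C) (d C) ⊎ SameEdge x y (d C) (a C)

vertices : {v : ℕ} → Cycle4 v → Subset v
vertices C = ⁅ a C ⁆ ∪ ⁅ b C ⁆ ∪ ⁅ c C ⁆ ∪ ⁅ d C ⁆

Is4CS : (v : ℕ) → List (Cycle4 v) → Set
Is4CS v 𝒞 = ∀ (x y : Fin v) → x ≢ y →
  ∃! _≡_ (λ (i : Fin (length 𝒞)) → EdgeOf x y (lookup 𝒞 i))

HasConfig : {v : ℕ} → List (Cycle4 v) → ℕ → ℕ → Set
HasConfig 𝒞 k l =
  Σ (List (Fin (length 𝒞))) λ is →
    Unique is × length is ≡ l
    × ∣ ⋃ (map (λ i → vertices (lookup 𝒞 i)) is) ∣ ≡ k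

Sparse : {v : ℕ} → ℕ → List (Cycle4 v) → Set
Sparse r 𝒞 = ∀ (j : ℕ) → 2 ≤ j → j ≤ r → ¬ HasConfig 𝒞 (j + 3) j

{-# OPTIONS --safe #-}

-- Necessity is the usual count: every point lies on r = (v - 1)/2 cycles and there are
-- v(v - 1)/8 cycles, so 4 divides r(2r + 1) and hence r.
--
-- For sufficiency, v = 8k + 1, take a point 0 and k ordered blocks of eight points. Each
-- block together with 0 carries a copy of a cyclic 4CS(9). Each block has two disjoint
-- perfect matchings, "upper" and "lower"; for blocks I before J, the cycles joining I to J
-- are the K₂,₂ between an upper pair of I and a lower pair of J. Since the matchings are
-- disjoint, few of these cycles fit into a small point set S: if e = [0 ∈ S], s = |S| - e,
-- and S contains P lower pairs and N cycles, then for e + s ≤ 7 one has P ≤ s/2,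
-- N ≤ e + s - 4 (N ≤ 1 if e + s = 4), and P + N ≤ 2 if e + s = 4. These bounds survive
-- putting a further block in front, which is a finite check over the subsets of 0 and
-- that block. A (j + 3, j)-configuration with 2 ≤ j ≤ 4 would violate the bound on N.
module Submission where

open import Defs
open import Data.Bool using (Bool; true; false; if_then_else_)
open import Data.Nat using (ℕ; zero; suc; _+_; _*_; _∸_; _/_; _≤_; _<_; _%_; z≤n; s≤s; ⌊_/2⌋)
open import Data.Nat.Properties
open import Data.Nat.DivMod using (_mod_; m≡m%n+[m/n]*n; [m+kn]%n≡m%n)
open import Data.Nat.Divisibility using (_∣_; divides; ∣m+n∣m⇒∣n; ∣-trans; m∣m*n; n∣m*n)
open import Data.Nat.ListAction using () renaming (sum to sumₗ)
open import Data.Nat.ListAction.Properties using (sum-++)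
open import Data.Nat.Tactic.RingSolver using (solve-∀)
open import Data.Fin using (Fin; zero; suc; toℕ; _↑ˡ_; _↑ʳ_; splitAt; join; #_)
import Data.Fin.Properties as Fin
open import Data.Fin.Patterns using (0F; 1F; 2F; 3F)
open import Data.Fin.Subset using (Subset; ⋃; ∣_∣; _∈_; _⊆_)
import Data.Fin.Subset.Properties as Subset
open import Data.List using (List; []; _∷_; _++_; map; length; lookup; allFin; cartesianProductWith)
open import Data.List.Properties using (map-++; map-∘)
open import Data.List.Membership.Propositional using () renaming (_∈_ to _∈ₗ_)
open import Data.List.Membership.Propositional.Properties using (∈-map⁺)
open import Data.List.Relation.Unary.All using (All; []; _∷_)
import Data.List.Relation.Unary.All as All
open import Data.List.Relation.Unary.AllPairs using ([]; _∷_)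
open import Data.List.Relation.Unary.Any using (here; there)
open import Data.List.Relation.Unary.Unique.Propositional using (Unique)
open import Data.Product using (Σ; ∃-syntax; _×_; _,_; proj₁; proj₂)
open import Data.Sum using (_⊎_; inj₁; inj₂; [_,_]′)
import Data.Vec as Vec
import Data.Vec.Properties as Vec
open import Function using (_∘_; _$_)
open import Function.Bundles using (_⇔_; mk⇔)
open import Function.Definitions using (Injective)
open import Relation.Nullary using (Dec; yes; no; does; contradiction)
open import Relation.Nullary.Decidable using (_×-dec_; _→-dec_; ¬?; from-yes; from-no; map′; decidable-stable; dec-true; dec-false)
open import Relation.Binary.PropositionalEquality
open import Algebra.Properties.Semiring.Sum +-*-semiring
  using (sum; sum-syntax; sum-cong-≗; sum-replicate-zero; ∑-distrib-+; *-distribˡ-sum)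

private variable
  A B C : Set
  m n v : ℕ

-- Finite sums over lists and over `Fin n`

Σₗ : (A → ℕ) → List A → ℕ
Σₗ f xs = sumₗ (map f xs)

Σₗ-++ : (f : A → ℕ) (xs ys : List A) → Σₗ f (xs ++ ys) ≡ Σₗ f xs + Σₗ f ys
Σₗ-++ f xs ys = trans (cong sumₗ (map-++ f xs ys)) (sum-++ (map f xs) (map f ys))

Σₗ-map : (f : B → ℕ) (g : A → B) (xs : List A) → Σₗ f (map g xs) ≡ Σₗ (f ∘ g) xs
Σₗ-map f g xs = cong sumₗ (sym (map-∘ xs))

Σₗ-cong : {f g : A → ℕ} → (∀ x → f x ≡ g x) → ∀ xs → Σₗ f xs ≡ Σₗ g xs
Σₗ-cong f≗g []       = refl
Σₗ-cong f≗g (x ∷ xs) = cong₂ _+_ (f≗g x) (Σₗ-cong f≗g xs)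

Σₗ-const : ∀ c (xs : List A) → Σₗ (λ _ → c) xs ≡ length xs * c
Σₗ-const c []       = refl
Σₗ-const c (x ∷ xs) = cong (c +_) (Σₗ-const c xs)

Σₗ-zero : {f : A → ℕ} → (∀ x → f x ≡ 0) → ∀ xs → Σₗ f xs ≡ 0
Σₗ-zero f≗0 xs = trans (Σₗ-cong f≗0 xs) (trans (Σₗ-const 0 xs) (*-zeroʳ (length xs)))

Σₗ-* : ∀ c (f : A → ℕ) xs → Σₗ (λ x → c * f x) xs ≡ c * Σₗ f xs
Σₗ-* c f []       = sym (*-zeroʳ c)
Σₗ-* c f (x ∷ xs) = trans (cong (c * f x +_) (Σₗ-* c f xs)) (sym (*-distribˡ-+ c (f x) _))

-- Makes a count over all cycles joining two families of pairs the product of a count over each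
-- family.
Σₗ-cartesianProductWith : (h : C → ℕ) (f : A → ℕ) (g : B → ℕ) (_∙_ : A → B → C) →
  (∀ x y → h (x ∙ y) ≡ f x * g y) → ∀ xs ys →
  Σₗ h (cartesianProductWith _∙_ xs ys) ≡ Σₗ f xs * Σₗ g ys
Σₗ-cartesianProductWith h f g _∙_ h≗ []       ys = refl
Σₗ-cartesianProductWith h f g _∙_ h≗ (x ∷ xs) ys = begin
  Σₗ h (map (x ∙_) ys ++ cartesianProductWith _∙_ xs ys)
    ≡⟨ Σₗ-++ h (map (x ∙_) ys) _ ⟩
  Σₗ h (map (x ∙_) ys) + Σₗ h (cartesianProductWith _∙_ xs ys)
    ≡⟨ cong₂ _+_ (trans (Σₗ-map h (x ∙_) ys) (Σₗ-cong (h≗ x) ys))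
                 (Σₗ-cartesianProductWith h f g _∙_ h≗ xs ys) ⟩
  Σₗ (λ y → f x * g y) ys + Σₗ f xs * Σₗ g ys
    ≡⟨ cong (_+ Σₗ f xs * Σₗ g ys) (Σₗ-* (f x) g ys) ⟩
  f x * Σₗ g ys + Σₗ f xs * Σₗ g ys
    ≡⟨ *-distribʳ-+ (Σₗ g ys) (f x) _ ⟨
  (f x + Σₗ f xs) * Σₗ g ys ∎
  where open ≡-Reasoning

∑-Σₗ-comm : (f : Fin n → A → ℕ) (xs : List A) →
  ∑[ i < n ] Σₗ (f i) xs ≡ Σₗ (λ x → ∑[ i < n ] f i x) xs
∑-Σₗ-comm {n} f []       = sum-replicate-zero n
∑-Σₗ-comm     f (x ∷ xs) =
  trans (∑-distrib-+ (λ i → f i x) (λ i → Σₗ (f i) xs)) (cong (_ +_) (∑-Σₗ-comm f xs))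

∑-lookup : (f : A → ℕ) (xs : List A) → ∑[ i < length xs ] f (lookup xs i) ≡ Σₗ f xs
∑-lookup f []       = refl
∑-lookup f (x ∷ xs) = cong (f x +_) (∑-lookup f xs)

∑-++ : ∀ m (f : Fin (m + n) → ℕ) →
  ∑[ i < m + n ] f i ≡ ∑[ i < m ] f (i ↑ˡ n) + ∑[ j < n ] f (m ↑ʳ j)
∑-++ zero    f = refl
∑-++ (suc m) f = trans (cong (f zero +_) (∑-++ m (f ∘ suc))) (sym (+-assoc (f zero) _ _))

∑-const : ∀ n c → ∑[ i < n ] c ≡ n * c
∑-const zero    c = refl
∑-const (suc n) c = cong (c +_) (∑-const n c)

∑-mono-≤ : {f g : Fin n → ℕ} → (∀ i → f i ≤ g i) → ∑[ i < n ] f i ≤ ∑[ i < n ] g i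
∑-mono-≤ {zero}  f≤g = z≤n
∑-mono-≤ {suc n} f≤g = +-mono-≤ (f≤g zero) (∑-mono-≤ (f≤g ∘ suc))

lookup≡0⇒Σₗ≡0 : (f : A → ℕ) (xs : List A) → (∀ i → f (lookup xs i) ≡ 0) → Σₗ f xs ≡ 0
lookup≡0⇒Σₗ≡0 f []       f≡0 = refl
lookup≡0⇒Σₗ≡0 f (x ∷ xs) f≡0 = cong₂ _+_ (f≡0 zero) (lookup≡0⇒Σₗ≡0 f xs (f≡0 ∘ suc))

Σₗ≡0⇒lookup≡0 : (f : A → ℕ) (xs : List A) → Σₗ f xs ≡ 0 → ∀ i → f (lookup xs i) ≡ 0
Σₗ≡0⇒lookup≡0 f (x ∷ xs) eq zero    = m+n≡0⇒m≡0 (f x) eq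
Σₗ≡0⇒lookup≡0 f (x ∷ xs) eq (suc i) = Σₗ≡0⇒lookup≡0 f xs (m+n≡0⇒n≡0 (f x) eq) i

unique-1⇒Σₗ≡1 : (f : A → ℕ) (xs : List A) (i : Fin (length xs)) → f (lookup xs i) ≡ 1 →
  (∀ j → i ≢ j → f (lookup xs j) ≡ 0) → Σₗ f xs ≡ 1
unique-1⇒Σₗ≡1 f (x ∷ xs) zero    fi≡1 f≡0 =
  cong₂ _+_ fi≡1 (lookup≡0⇒Σₗ≡0 f xs (λ j → f≡0 (suc j) λ ()))
unique-1⇒Σₗ≡1 f (x ∷ xs) (suc i) fi≡1 f≡0 =
  cong₂ _+_ (f≡0 zero λ ())
    (unique-1⇒Σₗ≡1 f xs i fi≡1 (λ j i≢j → f≡0 (suc j) (i≢j ∘ Fin.suc-injective)))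

Σₗ≡1⇒unique-1 : (f : A → ℕ) (xs : List A) → Σₗ f xs ≡ 1 →
  ∃[ i ] (f (lookup xs i) ≡ 1 × (∀ j → f (lookup xs j) ≢ 0 → i ≡ j))
Σₗ≡1⇒unique-1 f (x ∷ xs) eq with f x in fx
... | 0 = let i , fi≡1 , unique = Σₗ≡1⇒unique-1 f xs eq in
  suc i , fi≡1 , λ { zero fx≢0 → contradiction fx fx≢0 ; (suc j) fj≢0 → cong suc (unique j fj≢0) }
... | 1 = zero , fx , λ
  { zero    _    → refl
  ; (suc j) fj≢0 → contradiction (Σₗ≡0⇒lookup≡0 f xs (suc-injective eq) j) fj≢0 }

-- Edge multiplicities in place of edge membership

δ : Fin n → Fin n → ℕ
δ x y = if does (x Fin.≟ y) then 1 else 0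

δ-refl : (x : Fin n) → δ x x ≡ 1
δ-refl x = cong (if_then 1 else 0) (dec-true (x Fin.≟ x) refl)

δ-≢ : {x y : Fin n} → x ≢ y → δ x y ≡ 0
δ-≢ {x = x} {y} x≢y = cong (if_then 1 else 0) (dec-false (x Fin.≟ y) x≢y)

δ≡0⊎≡ : (x y : Fin n) → δ x y ≡ 0 ⊎ x ≡ y
δ≡0⊎≡ x y with x Fin.≟ y
... | yes x≡y = inj₂ x≡y
... | no  _   = inj₁ refl

δ-injective : {f : Fin m → Fin n} → Injective _≡_ _≡_ f → ∀ x y → δ (f x) (f y) ≡ δ x y
δ-injective {f = f} inj x y with x Fin.≟ y
... | yes refl = δ-refl (f x)
... | no  x≢y  = δ-≢ (x≢y ∘ inj)

∑-δ : (y : Fin n) → ∑[ x < n ] δ x y ≡ 1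
∑-δ {suc n} zero    = cong suc (sum-replicate-zero n)
∑-δ {suc n} (suc y) = trans (sum-cong-≗ (λ x → δ-injective Fin.suc-injective x y)) (∑-δ y)

-- For `p ≢ q` this is the 0/1 indicator of `SameEdge x y p q`, as a polynomial in `δ` so that sums
-- and ring identities apply.
edge : Fin n → Fin n → Fin n → Fin n → ℕ
edge x y p q = δ x p * δ y q + δ x q * δ y p

covers : Fin v → Fin v → Cycle4 v → ℕ
covers x y C =
  edge x y (a C) (b C) + (edge x y (b C) (c C) + (edge x y (c C) (d C) + edge x y (d C) (a C)))

edge-sym : (x y p q : Fin n) → edge x y p q ≡ edge y x p q
edge-sym x y p q = lemma (δ x p) (δ y q) (δ x q) (δ y p)
  where
  lemma : ∀ i j k l → i * j + k * l ≡ l * k + j * i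
  lemma = solve-∀

covers-sym : (x y : Fin v) (C : Cycle4 v) → covers x y C ≡ covers y x C
covers-sym x y C = cong₂ _+_ (edge-sym x y _ _) $ cong₂ _+_ (edge-sym x y _ _) $
  cong₂ _+_ (edge-sym x y _ _) (edge-sym x y _ _)

mapCycle : (f : Fin m → Fin n) → Injective _≡_ _≡_ f → Cycle4 m → Cycle4 n
mapCycle f inj (cyc a b c d a≢b a≢c a≢d b≢c b≢d c≢d) =
  cyc (f a) (f b) (f c) (f d) (a≢b ∘ inj) (a≢c ∘ inj) (a≢d ∘ inj) (b≢c ∘ inj) (b≢d ∘ inj) (c≢d ∘ inj)

covers-mapCycle : (f : Fin m → Fin n) (inj : Injective _≡_ _≡_ f) (x y : Fin m) (C : Cycle4 m) →
  covers (f x) (f y) (mapCycle f inj C) ≡ covers x y C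
covers-mapCycle f inj x y C = cong₂ _+_ (edge-map _ _) $ cong₂ _+_ (edge-map _ _) $
  cong₂ _+_ (edge-map _ _) (edge-map _ _)
  where
  edge-map : ∀ p q → edge (f x) (f y) (f p) (f q) ≡ edge x y p q
  edge-map p q = cong₂ _+_ (cong₂ _*_ (δ-injective inj x p) (δ-injective inj y q))
                           (cong₂ _*_ (δ-injective inj x q) (δ-injective inj y p))

edge≡0⊎SameEdge : (x y p q : Fin n) → edge x y p q ≡ 0 ⊎ SameEdge x y p q
edge≡0⊎SameEdge x y p q with x Fin.≟ p | y Fin.≟ q | x Fin.≟ q | y Fin.≟ p
... | yes x≡p | yes y≡q | _       | _       = inj₂ (inj₁ (x≡p , y≡q))
... | _       | _       | yes x≡q | yes y≡p = inj₂ (inj₂ (x≡q , y≡p))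
... | no _    | _       | no _    | _       = inj₁ refl
... | no _    | _       | yes _   | no _    = inj₁ refl
... | yes _   | no _    | no _    | _       = inj₁ refl
... | yes _   | no _    | yes _   | no _    = inj₁ refl

covers≡0⊎EdgeOf : (x y : Fin v) (C : Cycle4 v) → covers x y C ≡ 0 ⊎ EdgeOf x y C
covers≡0⊎EdgeOf x y C
  with edge≡0⊎SameEdge x y (a C) (b C) | edge≡0⊎SameEdge x y (b C) (c C)
     | edge≡0⊎SameEdge x y (c C) (d C) | edge≡0⊎SameEdge x y (d C) (a C)
... | inj₂ ab | _       | _       | _       = inj₂ (inj₁ ab)
... | _       | inj₂ bc | _       | _       = inj₂ (inj₂ (inj₁ bc))
... | _       | _       | inj₂ cd | _       = inj₂ (inj₂ (inj₂ (inj₁ cd)))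
... | _       | _       | _       | inj₂ da = inj₂ (inj₂ (inj₂ (inj₂ da)))
... | inj₁ ab | inj₁ bc | inj₁ cd | inj₁ da =
  inj₁ (cong₂ _+_ ab (cong₂ _+_ bc (cong₂ _+_ cd da)))

corner : Cycle4 v → Fin 4 → Fin v
corner C 0F = a C
corner C 1F = b C
corner C 2F = c C
corner C 3F = d C

corner-injective : (C : Cycle4 v) → Injective _≡_ _≡_ (corner C)
corner-injective C {0F} {0F} _  = refl
corner-injective C {0F} {1F} eq = contradiction eq (a≢b C)
corner-injective C {0F} {2F} eq = contradiction eq (a≢c C)
corner-injective C {0F} {3F} eq = contradiction eq (a≢d C)
corner-injective C {1F} {0F} eq = contradiction (sym eq) (a≢b C)
corner-injective C {1F} {1F} _  = refl
corner-injective C {1F} {2F} eq = contradiction eq (b≢c C)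
corner-injective C {1F} {3F} eq = contradiction eq (b≢d C)
corner-injective C {2F} {0F} eq = contradiction (sym eq) (a≢c C)
corner-injective C {2F} {1F} eq = contradiction (sym eq) (b≢c C)
corner-injective C {2F} {2F} _  = refl
corner-injective C {2F} {3F} eq = contradiction eq (c≢d C)
corner-injective C {3F} {0F} eq = contradiction (sym eq) (a≢d C)
corner-injective C {3F} {1F} eq = contradiction (sym eq) (b≢d C)
corner-injective C {3F} {2F} eq = contradiction (sym eq) (c≢d C)
corner-injective C {3F} {3F} _  = refl

square : Cycle4 4
square = cyc 0F 1F 2F 3F (λ ()) (λ ()) (λ ()) (λ ()) (λ ()) (λ ())

-- `C` is the image of `square` under the injection `corner C`, and the right-hand side evaluates to
-- a numeral for concrete `i` and `j`.
covers-corner : (C : Cycle4 v) (i j : Fin 4) → covers (corner C i) (corner C j) C ≡ covers i j square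
covers-corner C i j = covers-mapCycle (corner C) (corner-injective C) i j square

EdgeOf⇒covers≡1 : (x y : Fin v) (C : Cycle4 v) → EdgeOf x y C → covers x y C ≡ 1
EdgeOf⇒covers≡1 _ _ C (inj₁ (inj₁ (refl , refl)))               = covers-corner C 0F 1F
EdgeOf⇒covers≡1 _ _ C (inj₁ (inj₂ (refl , refl)))               = covers-corner C 1F 0F
EdgeOf⇒covers≡1 _ _ C (inj₂ (inj₁ (inj₁ (refl , refl))))        = covers-corner C 1F 2F
EdgeOf⇒covers≡1 _ _ C (inj₂ (inj₁ (inj₂ (refl , refl))))        = covers-corner C 2F 1F
EdgeOf⇒covers≡1 _ _ C (inj₂ (inj₂ (inj₁ (inj₁ (refl , refl))))) = covers-corner C 2F 3F
EdgeOf⇒covers≡1 _ _ C (inj₂ (inj₂ (inj₁ (inj₂ (refl , refl))))) = covers-corner C 3F 2F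
EdgeOf⇒covers≡1 _ _ C (inj₂ (inj₂ (inj₂ (inj₁ (refl , refl))))) = covers-corner C 3F 0F
EdgeOf⇒covers≡1 _ _ C (inj₂ (inj₂ (inj₂ (inj₂ (refl , refl))))) = covers-corner C 0F 3F

-- `Is4CS` as a count. Unlike unique existence of an index, a count splits along `++`, `map` and
-- products of lists.
CoversOnce : (v : ℕ) → List (Cycle4 v) → Set
CoversOnce v 𝒞 = ∀ (x y : Fin v) → x ≢ y → Σₗ (covers x y) 𝒞 ≡ 1

Is4CS⇒CoversOnce : (𝒞 : List (Cycle4 v)) → Is4CS v 𝒞 → CoversOnce v 𝒞
Is4CS⇒CoversOnce 𝒞 is4cs x y x≢y = let i , xy∈i , unique = is4cs x y x≢y in
  unique-1⇒Σₗ≡1 (covers x y) 𝒞 i (EdgeOf⇒covers≡1 x y (lookup 𝒞 i) xy∈i) λ j i≢j →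
    [ (λ eq → eq) , (λ xy∈j → contradiction (unique xy∈j) i≢j) ]′ (covers≡0⊎EdgeOf x y (lookup 𝒞 j))

CoversOnce⇒Is4CS : (𝒞 : List (Cycle4 v)) → CoversOnce v 𝒞 → Is4CS v 𝒞
CoversOnce⇒Is4CS 𝒞 once x y x≢y = let i , fi≡1 , unique = Σₗ≡1⇒unique-1 (covers x y) 𝒞 (once x y x≢y) in
  i ,
  [ (λ fi≡0 → contradiction (trans (sym fi≡1) fi≡0) λ ()) , (λ e → e) ]′ (covers≡0⊎EdgeOf x y (lookup 𝒞 i)) ,
  λ {j} xy∈j → unique j λ fj≡0 → contradiction (trans (sym (EdgeOf⇒covers≡1 x y (lookup 𝒞 j) xy∈j)) fj≡0) λ ()

-- Necessity by double counting

∑-edge : (x p q : Fin n) → ∑[ y < n ] edge x y p q ≡ δ x p + δ x q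
∑-edge {n} x p q = begin
  ∑[ y < n ] edge x y p q
    ≡⟨ ∑-distrib-+ (λ y → δ x p * δ y q) (λ y → δ x q * δ y p) ⟩
  ∑[ y < n ] (δ x p * δ y q) + ∑[ y < n ] (δ x q * δ y p)
    ≡⟨ cong₂ _+_ (scaled-∑-δ (δ x p) q) (scaled-∑-δ (δ x q) p) ⟩
  δ x p + δ x q ∎
  where
  open ≡-Reasoning
  scaled-∑-δ : ∀ k z → ∑[ y < n ] (k * δ y z) ≡ k
  scaled-∑-δ k z = trans (sym (*-distribˡ-sum k (λ y → δ y z))) (trans (cong (k *_) (∑-δ z)) (*-identityʳ k))

onCycle : Fin v → Cycle4 v → ℕ
onCycle x C = δ x (a C) + (δ x (b C) + (δ x (c C) + δ x (d C)))

∑-distrib-+₄ : (f g h k : Fin n → ℕ) →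
  ∑[ i < n ] (f i + (g i + (h i + k i))) ≡ sum f + (sum g + (sum h + sum k))
∑-distrib-+₄ f g h k = trans (∑-distrib-+ f (λ i → g i + (h i + k i))) $ cong (sum f +_) $
  trans (∑-distrib-+ g (λ i → h i + k i)) $ cong (sum g +_) (∑-distrib-+ h k)

-- Each corner of a 4-cycle is an end of two of its edges.
∑-covers : (x : Fin v) (C : Cycle4 v) → ∑[ y < v ] covers x y C ≡ 2 * onCycle x C
∑-covers {v} x C = begin
  ∑[ y < v ] covers x y C
    ≡⟨ ∑-distrib-+₄ (λ y → edge x y (a C) (b C)) (λ y → edge x y (b C) (c C))
                    (λ y → edge x y (c C) (d C)) (λ y → edge x y (d C) (a C)) ⟩
  _ ≡⟨ cong₂ _+_ (∑-edge x (a C) (b C)) (cong₂ _+_ (∑-edge x (b C) (c C))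
         (cong₂ _+_ (∑-edge x (c C) (d C)) (∑-edge x (d C) (a C)))) ⟩
  _ ≡⟨ double (δ x (a C)) (δ x (b C)) (δ x (c C)) (δ x (d C)) ⟩
  2 * onCycle x C ∎
  where
  open ≡-Reasoning
  double : ∀ i j k l → (i + j) + ((j + k) + ((k + l) + (l + i))) ≡ 2 * (i + (j + (k + l)))
  double = solve-∀

∑-onCycle : (C : Cycle4 v) → ∑[ x < v ] onCycle x C ≡ 4
∑-onCycle C =
  trans (∑-distrib-+₄ (λ x → δ x (a C)) (λ x → δ x (b C)) (λ x → δ x (c C)) (λ x → δ x (d C))) $
  cong₂ _+_ (∑-δ (a C)) (cong₂ _+_ (∑-δ (b C)) (cong₂ _+_ (∑-δ (c C)) (∑-δ (d C))))

covers-loop : (x : Fin v) (C : Cycle4 v) → covers x x C ≡ 0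
covers-loop x C with covers≡0⊎EdgeOf x x C
... | inj₁ eq                                         = eq
... | inj₂ (inj₁ (inj₁ (p , q)))                      = contradiction (trans (sym p) q) (a≢b C)
... | inj₂ (inj₁ (inj₂ (p , q)))                      = contradiction (trans (sym q) p) (a≢b C)
... | inj₂ (inj₂ (inj₁ (inj₁ (p , q))))               = contradiction (trans (sym p) q) (b≢c C)
... | inj₂ (inj₂ (inj₁ (inj₂ (p , q))))               = contradiction (trans (sym q) p) (b≢c C)
... | inj₂ (inj₂ (inj₂ (inj₁ (inj₁ (p , q)))))        = contradiction (trans (sym p) q) (c≢d C)
... | inj₂ (inj₂ (inj₂ (inj₁ (inj₂ (p , q)))))        = contradiction (trans (sym q) p) (c≢d C)
... | inj₂ (inj₂ (inj₂ (inj₂ (inj₁ (p , q)))))        = contradiction (trans (sym q) p) (a≢d C)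
... | inj₂ (inj₂ (inj₂ (inj₂ (inj₂ (p , q)))))        = contradiction (trans (sym p) q) (a≢d C)

-- No cycle covers a loop; `δ y x` fills this gap at `y ≡ x`, so that the sum over all `y` is `v`.
Σₗ-covers+δ : (𝒞 : List (Cycle4 v)) → CoversOnce v 𝒞 → ∀ x y → Σₗ (covers x y) 𝒞 + δ y x ≡ 1
Σₗ-covers+δ 𝒞 once x y with y Fin.≟ x
... | yes refl = cong (_+ 1) (Σₗ-zero (covers-loop x) 𝒞)
... | no  y≢x  = trans (+-identityʳ _) (once x y (≢-sym y≢x))

replication : (𝒞 : List (Cycle4 v)) → CoversOnce v 𝒞 → ∀ x → 2 * Σₗ (onCycle x) 𝒞 + 1 ≡ v
replication {v} 𝒞 once x = begin
  2 * Σₗ (onCycle x) 𝒞 + 1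
    ≡⟨ cong (_+ 1) (Σₗ-* 2 (onCycle x) 𝒞) ⟨
  Σₗ (λ C → 2 * onCycle x C) 𝒞 + 1
    ≡⟨ cong₂ _+_ (Σₗ-cong (∑-covers x) 𝒞) (∑-δ x) ⟨
  Σₗ (λ C → ∑[ y < v ] covers x y C) 𝒞 + ∑[ y < v ] δ y x
    ≡⟨ cong (_+ ∑[ y < v ] δ y x) (∑-Σₗ-comm (covers x) 𝒞) ⟨
  (∑[ y < v ] Σₗ (covers x y) 𝒞) + ∑[ y < v ] δ y x
    ≡⟨ ∑-distrib-+ (λ y → Σₗ (covers x y) 𝒞) (λ y → δ y x) ⟨
  ∑[ y < v ] (Σₗ (covers x y) 𝒞 + δ y x)
    ≡⟨ sum-cong-≗ (Σₗ-covers+δ 𝒞 once x) ⟩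
  ∑[ y < v ] 1
    ≡⟨ trans (∑-const v 1) (*-identityʳ v) ⟩
  v ∎
  where open ≡-Reasoning

-- 2r (r + 2r²) = 4r³ + 2r², so 4 divides 2r² and hence r.
4∣r[2r+1]⇒4∣r : ∀ r → 4 ∣ r * (2 * r + 1) → 4 ∣ r
4∣r[2r+1]⇒4∣r r 4∣ = ∣m+n∣m⇒∣n (subst (4 ∣_) (expand₁ r) 4∣)
  (∣m+n∣m⇒∣n (subst (4 ∣_) (expand₂ r) (∣-trans 4∣ (n∣m*n (2 * r)))) (m∣m*n (r * r * r)))
  where
  expand₁ : ∀ r → r * (2 * r + 1) ≡ 2 * (r * r) + r
  expand₁ = solve-∀
  expand₂ : ∀ r → 2 * r * (r * (2 * r + 1)) ≡ 4 * (r * r * r) + 2 * (r * r)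
  expand₂ = solve-∀

-- Incidences of points with cycles, counted both ways: each of the `2 * r + 1` points is on `r`
-- cycles, and each cycle has 4 points.
4∣replication : (𝒞 : List (Cycle4 (suc n))) → CoversOnce (suc n) 𝒞 → 4 ∣ Σₗ (onCycle zero) 𝒞
4∣replication {n} 𝒞 once = 4∣r[2r+1]⇒4∣r r $ divides (length 𝒞) $ begin
  r * (2 * r + 1)                          ≡⟨ *-comm r _ ⟩
  (2 * r + 1) * r                          ≡⟨ cong (_* r) (replication 𝒞 once zero) ⟩
  suc n * r                                ≡⟨ ∑-const (suc n) r ⟨
  ∑[ x < suc n ] r                         ≡⟨ sum-cong-≗ r-constant ⟨
  ∑[ x < suc n ] Σₗ (onCycle x) 𝒞          ≡⟨ ∑-Σₗ-comm onCycle 𝒞 ⟩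
  Σₗ (λ C → ∑[ x < suc n ] onCycle x C) 𝒞  ≡⟨ Σₗ-cong ∑-onCycle 𝒞 ⟩
  Σₗ (λ _ → 4) 𝒞                           ≡⟨ Σₗ-const 4 𝒞 ⟩
  length 𝒞 * 4                             ∎
  where
  open ≡-Reasoning
  r = Σₗ (onCycle zero) 𝒞
  r-constant : ∀ x → Σₗ (onCycle x) 𝒞 ≡ r
  r-constant x = *-cancelˡ-≡ _ _ 2 (+-cancelʳ-≡ 1 _ _
    (trans (replication 𝒞 once x) (sym (replication 𝒞 once zero))))

4∣r⇒[2r+1]%8≡1 : ∀ {r} → 4 ∣ r → (2 * r + 1) % 8 ≡ 1
4∣r⇒[2r+1]%8≡1 (divides q refl) = trans (cong (_% 8) (regroup q)) ([m+kn]%n≡m%n 1 q 8)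
  where
  regroup : ∀ q → 2 * (q * 4) + 1 ≡ 1 + q * 8
  regroup = solve-∀

CoversOnce⇒v%8≡1 : (𝒞 : List (Cycle4 v)) → 1 ≤ v → CoversOnce v 𝒞 → v % 8 ≡ 1
CoversOnce⇒v%8≡1 {suc n} 𝒞 _ once =
  subst (λ v → v % 8 ≡ 1) (replication 𝒞 once zero) (4∣r⇒[2r+1]%8≡1 (4∣replication 𝒞 once))

-- Pairs, diagonals, and adjoining a block of eight points

record Pair (n : ℕ) : Set where
  constructor pair
  field
    fst snd : Fin n
    fst≢snd : fst ≢ snd

open Pair

mapPair : (f : Fin m → Fin n) → Injective _≡_ _≡_ f → Pair m → Pair n
mapPair f inj (pair p q p≢q) = pair (f p) (f q) (p≢q ∘ inj)

onPair : Fin n → Pair n → ℕ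
onPair z P = δ z (fst P) + δ z (snd P)

onPair-mapPair : (f : Fin m → Fin n) (inj : Injective _≡_ _≡_ f) (z : Fin m) (P : Pair m) →
  onPair (f z) (mapPair f inj P) ≡ onPair z P
onPair-mapPair f inj z P = cong₂ _+_ (δ-injective inj z (fst P)) (δ-injective inj z (snd P))

onPair-miss : {z : Fin n} (P : Pair n) → z ≢ fst P → z ≢ snd P → onPair z P ≡ 0
onPair-miss P z≢p z≢q = cong₂ _+_ (δ-≢ z≢p) (δ-≢ z≢q)

diagonal₁ diagonal₂ : Cycle4 v → Pair v
diagonal₁ C = pair (a C) (c C) (a≢c C)
diagonal₂ C = pair (b C) (d C) (b≢d C)

-- A 4-cycle is a complete bipartite graph whose two sides are its diagonals.
covers-diagonals : (x y : Fin v) (C : Cycle4 v) → covers x y C ≡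
  onPair x (diagonal₁ C) * onPair y (diagonal₂ C) + onPair x (diagonal₂ C) * onPair y (diagonal₁ C)
covers-diagonals x y C =
  lemma (δ x (a C)) (δ x (b C)) (δ x (c C)) (δ x (d C)) (δ y (a C)) (δ y (b C)) (δ y (c C)) (δ y (d C))
  where
  lemma : ∀ i j k l i′ j′ k′ l′ →
    (i * j′ + j * i′) + ((j * k′ + k * j′) + ((k * l′ + l * k′) + (l * i′ + i * l′))) ≡
    (i + k) * (j′ + l′) + (j + l) * (i′ + k′)
  lemma = solve-∀

covers-missʳ : (x y : Fin v) (C : Cycle4 v) → onPair y (diagonal₁ C) ≡ 0 → onPair y (diagonal₂ C) ≡ 0 →
  covers x y C ≡ 0
covers-missʳ x y C y∉₁ y∉₂ = trans (covers-diagonals x y C) $ cong₂ _+_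
  (trans (cong (onPair x (diagonal₁ C) *_) y∉₂) (*-zeroʳ (onPair x (diagonal₁ C))))
  (trans (cong (onPair x (diagonal₂ C) *_) y∉₁) (*-zeroʳ (onPair x (diagonal₂ C))))

-- The points of a system with a new block of eight points: 0 is common to the block and
-- to the old system, 1, …, 8 are the block, and the remaining points are old.
left : Fin 9 → Fin (9 + n)
left i = i ↑ˡ _

right : Fin (1 + n) → Fin (9 + n)
right zero    = zero
right (suc z) = 9 ↑ʳ z

left-injective : Injective _≡_ _≡_ (left {n})
left-injective {n} = Fin.↑ˡ-injective n _ _

right-injective : Injective _≡_ _≡_ (right {n})
right-injective {x = zero}  {zero}  _  = refl
right-injective {x = suc z} {suc t} eq = cong suc (Fin.↑ʳ-injective 9 z t eq)

↑ˡ≢↑ʳ : ∀ m (i : Fin m) (j : Fin n) → i ↑ˡ n ≢ m ↑ʳ j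
↑ˡ≢↑ʳ {n} m i j eq
  with trans (sym (Fin.splitAt-↑ˡ m i n)) (trans (cong (splitAt m) eq) (Fin.splitAt-↑ʳ m n j))
... | ()

left≢right : (i : Fin 9) (z : Fin n) → left i ≢ right (suc z)
left≢right = ↑ˡ≢↑ʳ 9

right≢left : (j : Fin (1 + n)) (r : Fin 8) → right j ≢ left (suc r)
right≢left (suc z) r = ≢-sym (left≢right (suc r) z)

newCycle : Cycle4 9 → Cycle4 (9 + n)
newCycle = mapCycle left left-injective

oldCycle : Cycle4 (1 + n) → Cycle4 (9 + n)
oldCycle = mapCycle right right-injective

data Point {n} : Fin (9 + n) → Set where
  origin : Point zero
  new    : (r : Fin 8) → Point (left (suc r))
  old    : (z : Fin n) → Point (right (suc z))

point : (x : Fin (9 + n)) → Point x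
point zero        = origin
point {n} (suc x) = subst (Point ∘ suc) (Fin.join-splitAt 8 n x) (split (splitAt 8 x))
  where
  split : (s : Fin 8 ⊎ Fin n) → Point (suc (join 8 n s))
  split (inj₁ r) = new r
  split (inj₂ z) = old z

-- The system of order 9 and the recursive construction

_⊕_ : Fin 9 → Fin 9 → Fin 9
i ⊕ j = (toℕ i + toℕ j) mod 9

⊕-injective : ∀ t → Injective _≡_ _≡_ (_⊕ t)
⊕-injective t {i} {j} = from-yes
  (Fin.all? λ t → Fin.all? λ i → Fin.all? λ j → (i ⊕ t Fin.≟ j ⊕ t) →-dec (i Fin.≟ j)) t i j

starter : Cycle4 9
starter = cyc (# 0) (# 1) (# 5) (# 2) (λ ()) (λ ()) (λ ()) (λ ()) (λ ()) (λ ())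

-- A cyclic system: the sides of the starter have differences 1, 4, 3, 2 modulo 9.
system₉ : List (Cycle4 9)
system₉ = map (λ t → mapCycle (_⊕ t) (⊕-injective t) starter) (allFin 9)

system₉-once : CoversOnce 9 system₉
system₉-once = from-yes
  (Fin.all? λ x → Fin.all? λ y → ¬? (x Fin.≟ y) →-dec (Σₗ (covers x y) system₉ ≟ 1))

-- Two disjoint perfect matchings of the block, neither of which contains two edges
-- whose union is the vertex set of a cycle of system₉.
upper lower : List (Pair 8)
upper = pair (# 0) (# 1) (λ ()) ∷ pair (# 2) (# 3) (λ ()) ∷
        pair (# 4) (# 5) (λ ()) ∷ pair (# 6) (# 7) (λ ()) ∷ []
lower = pair (# 0) (# 4) (λ ()) ∷ pair (# 1) (# 5) (λ ()) ∷
        pair (# 2) (# 6) (λ ()) ∷ pair (# 3) (# 7) (λ ()) ∷ []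

newPair : ∀ n → Pair 8 → Pair (8 + n)
newPair n = mapPair (_↑ˡ n) (Fin.↑ˡ-injective n _ _)

oldPair : Pair n → Pair (8 + n)
oldPair = mapPair (8 ↑ʳ_) (Fin.↑ʳ-injective 8 _ _)

lowers : ∀ k → List (Pair (k * 8))
lowers zero    = []
lowers (suc k) = map (newPair (k * 8)) lower ++ map oldPair (lowers k)

-- The pairs become the two diagonals, so the edges are those of the K₂,₂ between them. Each `suc`
-- skips the common point 0.
cross : Pair 8 → Pair n → Cycle4 (9 + n)
cross (pair p p′ p≢p′) (pair q q′ q≢q′) =
  cyc (left (suc p)) (right (suc q)) (left (suc p′)) (right (suc q′))
    (left≢right (suc p) q) (p≢p′ ∘ Fin.suc-injective ∘ left-injective) (left≢right (suc p) q′)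
    (≢-sym (left≢right (suc p′) q)) (q≢q′ ∘ Fin.suc-injective ∘ right-injective) (left≢right (suc p′) q′)

-- The new block comes first in the order of blocks: it gives its upper pairs, and all older blocks
-- give their lower pairs.
system : ∀ k → List (Cycle4 (1 + k * 8))
system zero    = []
system (suc k) =
  map newCycle system₉ ++
  (map oldCycle (system k) ++ cartesianProductWith cross upper (lowers k))

-- Every edge is covered exactly once

upper-once : ∀ r → Σₗ (onPair r) upper ≡ 1
upper-once = from-yes (Fin.all? λ r → Σₗ (onPair r) upper ≟ 1)

lower-once : ∀ r → Σₗ (onPair r) lower ≡ 1
lower-once = from-yes (Fin.all? λ r → Σₗ (onPair r) lower ≟ 1)

Σₗ-lowers : ∀ k (f : Pair (8 + k * 8) → ℕ) →
  Σₗ f (lowers (suc k)) ≡ Σₗ (f ∘ newPair (k * 8)) lower + Σₗ (f ∘ oldPair) (lowers k)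
Σₗ-lowers k f = trans (Σₗ-++ f (map (newPair (k * 8)) lower) (map oldPair (lowers k)))
  (cong₂ _+_ (Σₗ-map f (newPair (k * 8)) lower) (Σₗ-map f oldPair (lowers k)))

lowers-once : ∀ k (z : Fin (k * 8)) → Σₗ (onPair z) (lowers k) ≡ 1
lowers-once (suc k) z = subst (λ z → Σₗ (onPair z) (lowers (suc k)) ≡ 1)
  (Fin.join-splitAt 8 (k * 8) z) (split (splitAt 8 z))
  where
  split : (s : Fin 8 ⊎ Fin (k * 8)) → Σₗ (onPair (join 8 (k * 8) s)) (lowers (suc k)) ≡ 1
  split (inj₁ r) = trans (Σₗ-lowers k (onPair (r ↑ˡ k * 8))) $ cong₂ _+_
    (trans (Σₗ-cong (onPair-mapPair _ (Fin.↑ˡ-injective _ _ _) r) lower) (lower-once r))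
    (Σₗ-zero (λ P → onPair-miss (oldPair P) (↑ˡ≢↑ʳ 8 r (fst P)) (↑ˡ≢↑ʳ 8 r (snd P))) (lowers k))
  split (inj₂ t) = trans (Σₗ-lowers k (onPair (8 ↑ʳ t))) $ cong₂ _+_
    (Σₗ-zero (λ P → onPair-miss (newPair (k * 8) P)
      (≢-sym (↑ˡ≢↑ʳ 8 (fst P) t)) (≢-sym (↑ˡ≢↑ʳ 8 (snd P) t))) lower)
    (trans (Σₗ-cong (onPair-mapPair _ (Fin.↑ʳ-injective 8 _ _) t) (lowers k)) (lowers-once k t))

Σₗ-system : ∀ k (f : Cycle4 (9 + k * 8) → ℕ) → Σₗ f (system (suc k)) ≡
  Σₗ (f ∘ newCycle) system₉ +
  (Σₗ (f ∘ oldCycle) (system k) + Σₗ f (cartesianProductWith cross upper (lowers k)))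
Σₗ-system k f = begin
  Σₗ f (system (suc k))
    ≡⟨ Σₗ-++ f (map newCycle system₉) (map oldCycle (system k) ++ crosses) ⟩
  Σₗ f (map newCycle system₉) + Σₗ f (map oldCycle (system k) ++ crosses)
    ≡⟨ cong₂ _+_ (Σₗ-map f newCycle system₉) (Σₗ-++ f (map oldCycle (system k)) crosses) ⟩
  Σₗ (f ∘ newCycle) system₉ + (Σₗ f (map oldCycle (system k)) + Σₗ f crosses)
    ≡⟨ cong (λ t → Σₗ (f ∘ newCycle) system₉ + (t + Σₗ f crosses)) (Σₗ-map f oldCycle (system k)) ⟩
  Σₗ (f ∘ newCycle) system₉ + (Σₗ (f ∘ oldCycle) (system k) + Σₗ f crosses) ∎
  where
  open ≡-Reasoning
  crosses = cartesianProductWith cross upper (lowers k)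

left-old : (z : Fin n) (P : Pair 9) → onPair (right (suc z)) (mapPair left left-injective P) ≡ 0
left-old z P = onPair-miss (mapPair left left-injective P)
  (≢-sym (left≢right (fst P) z)) (≢-sym (left≢right (snd P) z))

right-new : (r : Fin 8) (P : Pair (1 + n)) → onPair (left (suc r)) (mapPair right right-injective P) ≡ 0
right-new r P = onPair-miss (mapPair right right-injective P)
  (≢-sym (right≢left (fst P) r)) (≢-sym (right≢left (snd P) r))

covers-newCycle-old : ∀ x (z : Fin n) C → covers x (right (suc z)) (newCycle C) ≡ 0
covers-newCycle-old x z C = covers-missʳ x (right (suc z)) (newCycle C)
  (left-old z (diagonal₁ C)) (left-old z (diagonal₂ C))

covers-oldCycle-new : ∀ x r (C : Cycle4 (1 + n)) → covers x (left (suc r)) (oldCycle C) ≡ 0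
covers-oldCycle-new x r C = covers-missʳ x (left (suc r)) (oldCycle C)
  (right-new r (diagonal₁ C)) (right-new r (diagonal₂ C))

left-off-diagonal₂ : ∀ i (p : Pair 8) (q : Pair n) → onPair (left i) (diagonal₂ (cross p q)) ≡ 0
left-off-diagonal₂ i p q =
  onPair-miss (diagonal₂ (cross p q)) (left≢right i (fst q)) (left≢right i (snd q))

right-off-diagonal₁ : ∀ j (p : Pair 8) (q : Pair n) → onPair (right j) (diagonal₁ (cross p q)) ≡ 0
right-off-diagonal₁ j p q =
  onPair-miss (diagonal₁ (cross p q)) (right≢left j (fst p)) (right≢left j (snd p))

Σₗ-cross-zero : (f : Cycle4 (9 + n) → ℕ) → (∀ p q → f (cross p q) ≡ 0) → ∀ ps qs →
  Σₗ f (cartesianProductWith cross ps qs) ≡ 0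
Σₗ-cross-zero f f≡0 ps qs = trans
  (Σₗ-cartesianProductWith f (λ _ → 0) (λ _ → 0) cross f≡0 ps qs)
  (cong (_* Σₗ (λ _ → 0) qs) (Σₗ-zero (λ _ → refl) ps))

-- Every edge of a cycle has an end on its second diagonal, which here consists of old points.
covers-cross-left : ∀ i j (p : Pair 8) (q : Pair n) → covers (left i) (left j) (cross p q) ≡ 0
covers-cross-left i j p q = trans (covers-diagonals (left i) (left j) (cross p q)) $ cong₂ _+_
  (trans (cong (onPair (left i) (diagonal₁ (cross p q)) *_) (left-off-diagonal₂ j p q))
         (*-zeroʳ (onPair (left i) (diagonal₁ (cross p q)))))
  (cong (_* onPair (left j) (diagonal₁ (cross p q))) (left-off-diagonal₂ i p q))

covers-cross-right : ∀ i j (p : Pair 8) (q : Pair n) → covers (right i) (right j) (cross p q) ≡ 0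
covers-cross-right i j p q = trans (covers-diagonals (right i) (right j) (cross p q)) $ cong₂ _+_
  (cong (_* onPair (right j) (diagonal₂ (cross p q))) (right-off-diagonal₁ i p q))
  (trans (cong (onPair (right i) (diagonal₂ (cross p q)) *_) (right-off-diagonal₁ j p q))
         (*-zeroʳ (onPair (right i) (diagonal₂ (cross p q)))))

covers-cross : ∀ r z (p : Pair 8) (q : Pair n) →
  covers (left (suc r)) (right (suc z)) (cross p q) ≡ onPair r p * onPair z q
covers-cross r z p q = trans (covers-diagonals (left (suc r)) (right (suc z)) (cross p q)) $ trans
  (cong₂ _+_
    (cong₂ _*_
      (onPair-mapPair (left ∘ suc) (Fin.suc-injective ∘ left-injective) r p)
      (onPair-mapPair (right ∘ suc) (Fin.suc-injective ∘ right-injective) z q))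
    (cong (_* onPair (right (suc z)) (diagonal₁ (cross p q))) (left-off-diagonal₂ (suc r) p q)))
  (+-identityʳ (onPair r p * onPair z q))

-- The second point is never 0, so all old cycles miss it; `i` may be 0.
once-new : ∀ k i r → i ≢ suc r → Σₗ (covers (left i) (left (suc r))) (system (suc k)) ≡ 1
once-new k i r i≢r = trans (Σₗ-system k (covers (left i) (left (suc r)))) $ cong₂ _+_
  (trans (Σₗ-cong (covers-mapCycle left left-injective i (suc r)) system₉) (system₉-once i (suc r) i≢r)) $
  cong₂ _+_ (Σₗ-zero (covers-oldCycle-new (left i) r) (system k)) $
  Σₗ-cross-zero (covers (left i) (left (suc r))) (covers-cross-left i (suc r)) upper (lowers k)

once-old : ∀ k j z → Σₗ (covers j (suc z)) (system k) ≡ 1 →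
  Σₗ (covers (right j) (right (suc z))) (system (suc k)) ≡ 1
once-old k j z once = trans (Σₗ-system k (covers (right j) (right (suc z)))) $ cong₂ _+_
  (Σₗ-zero (covers-newCycle-old (right j) z) system₉) $ cong₂ _+_
  (trans (Σₗ-cong (covers-mapCycle right right-injective j (suc z)) (system k)) once) $
  Σₗ-cross-zero (covers (right j) (right (suc z))) (covers-cross-right j (suc z)) upper (lowers k)

-- The count factors into the upper pairs through `r` times the lower pairs through `z`; both
-- families are perfect matchings.
once-cross : ∀ k r z → Σₗ (covers (left (suc r)) (right (suc z))) (system (suc k)) ≡ 1
once-cross k r z = trans (Σₗ-system k (covers (left (suc r)) (right (suc z)))) $ cong₂ _+_
  (Σₗ-zero (covers-newCycle-old (left (suc r)) z) system₉) $ cong₂ _+_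
  (Σₗ-zero (λ C → trans (covers-sym (left (suc r)) (right (suc z)) (oldCycle C))
     (covers-oldCycle-new (right (suc z)) r C)) (system k)) $
  trans (Σₗ-cartesianProductWith (covers (left (suc r)) (right (suc z))) (onPair r) (onPair z) cross
    (covers-cross r z) upper (lowers k)) $
  cong₂ _*_ (upper-once r) (lowers-once k z)

system-once : ∀ k → CoversOnce (1 + k * 8) (system k)
system-once zero    zero zero x≢y = contradiction refl x≢y
system-once (suc k) x y x≢y with point x | point y
... | origin | origin = contradiction refl x≢y
... | origin | new r  = once-new k zero r λ ()
... | origin | old z  = once-old k zero z (system-once k zero (suc z) λ ())
... | new r  | new s  = once-new k (suc r) s (x≢y ∘ cong left)
... | new r  | old z  = once-cross k r z
... | old z  | old t  = once-old k (suc z) t (system-once k (suc z) (suc t) (x≢y ∘ cong right))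
... | new r  | origin = trans (Σₗ-cong (covers-sym x y) (system (suc k))) (once-new k zero r λ ())
... | old z  | origin = trans (Σₗ-cong (covers-sym x y) (system (suc k)))
                              (once-old k zero z (system-once k zero (suc z) λ ()))
... | old z  | new r  = trans (Σₗ-cong (covers-sym x y) (system (suc k))) (once-cross k r z)

-- Bounds for the cycles inside a small point set

𝟙 : Bool → ℕ
𝟙 b = if b then 1 else 0

inPair : (Fin n → ℕ) → Pair n → ℕ
inPair w P = w (fst P) * w (snd P)

-- Grouped by diagonals, so that on `cross p q` it is by computation the product of the two values
-- of `inPair`.
inCycle : (Fin v → ℕ) → Cycle4 v → ℕ
inCycle w C = inPair w (diagonal₁ C) * inPair w (diagonal₂ C)

-- The exception at 4 allows for the vertex set of a single cycle.
maxCycles : ℕ → ℕ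
maxCycles 4 = 1
maxCycles c = c ∸ 4

-- The last clause excludes `P ≡ 2` with `N ≡ 1` on four points: an upper pair put in front would
-- then make 1 + 1 * 2 = 3 cycles on six points, where only 2 are allowed.
Bounded : (e s P N : ℕ) → Set
Bounded e s P N = P ≤ ⌊ s /2⌋ × N ≤ maxCycles (e + s) × (e + s ≡ 4 → P + N ≤ 2)

bounded? : ∀ e s P N → Dec (Bounded e s P N)
bounded? e s P N = (P ≤? ⌊ s /2⌋) ×-dec (N ≤? maxCycles (e + s)) ×-dec ((e + s ≟ 4) →-dec (P + N ≤? 2))

-- A block meeting S in s′ points, p′ lower pairs and p upper pairs, and containing t cycles
-- of its system together with 0, is put in front: it gains t cycles inside and p * P across.
record Step (e s′ p′ p t : ℕ) : Set where
  constructor step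
  field
    extend : ∀ {s} → s < 8 → ∀ {P} → P < 4 → ∀ {N} → N < 4 →
      e + (s′ + s) ≤ 7 → Bounded e s P N → Bounded e (s′ + s) (p′ + P) (t + (N + p * P))

open Step

step? : ∀ e s′ p′ p t → Dec (Step e s′ p′ p t)
step? e s′ p′ p t = map′ step extend (allUpTo? (λ s → allUpTo? (λ P → allUpTo? (λ N →
  (e + (s′ + s) ≤? 7) →-dec (bounded? e s P N →-dec bounded? e (s′ + s) (p′ + P) (t + (N + p * P)))) 4) 4) 8)

BlockStep : (Fin 9 → ℕ) → Set
BlockStep w = Step (w zero) (∑[ r < 8 ] w (suc r))
  (Σₗ (inPair (w ∘ suc)) lower) (Σₗ (inPair (w ∘ suc)) upper) (Σₗ (inCycle w) system₉)

blockStep? : ∀ w → Dec (BlockStep w)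
blockStep? w = step? (w zero) (∑[ r < 8 ] w (suc r))
  (Σₗ (inPair (w ∘ suc)) lower) (Σₗ (inPair (w ∘ suc)) upper) (Σₗ (inCycle w) system₉)

-- An exhaustive search through the 512 subsets of 0 and a block finds no counterexample. This is
-- where the choice of `starter`, `upper` and `lower` matters.
blockStep-lookup : (u : Subset 9) → BlockStep (𝟙 ∘ Vec.lookup u)
blockStep-lookup u = decidable-stable (blockStep? (𝟙 ∘ Vec.lookup u)) λ ¬step →
  from-no (Subset.anySubset? λ u → ¬? (blockStep? (𝟙 ∘ Vec.lookup u))) (u , ¬step)

-- BlockStep applies its argument to numerals only, so this holds by computation.
blockStep : (S : Fin 9 → Bool) → BlockStep (𝟙 ∘ S)
blockStep S = blockStep-lookup (Vec.tabulate S)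

maxCycles≤3 : ∀ {c} → c < 8 → maxCycles c ≤ 3
maxCycles≤3 = from-yes (allUpTo? (λ c → maxCycles c ≤? 3) 8)

Bounded-resp-≡ : ∀ e {s s′ P P′ N N′} → s ≡ s′ → P ≡ P′ → N ≡ N′ → Bounded e s′ P′ N′ → Bounded e s P N
Bounded-resp-≡ e refl refl refl bounded = bounded

-- Induction on the number of blocks: `S ∘ right` removes the front block but keeps 0, so `e` is the
-- same for both parts of `S`.
system-bounded : ∀ k (S : Fin (1 + k * 8) → Bool) → let w = 𝟙 ∘ S in
  w zero + ∑[ i < k * 8 ] w (suc i) ≤ 7 →
  Bounded (w zero) (∑[ i < k * 8 ] w (suc i))
    (Σₗ (inPair (w ∘ suc)) (lowers k)) (Σₗ (inCycle w) (system k))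
system-bounded zero    S _  = z≤n , z≤n , λ _ → z≤n
system-bounded (suc k) S ≤7 =
  Bounded-resp-≡ e size≡ (Σₗ-lowers k (inPair (w ∘ suc))) cycles≡ $
  -- `s ≤ 7` gives `P` at most 3, and `e + s ≤ 7` gives `N` at most 3, so the ranges of the finite
  -- check suffice.
  extend (blockStep (S ∘ left)) (s≤s s≤7)
    (s≤s (≤-trans P≤ (⌊n/2⌋-mono s≤7)))
    (s≤s (≤-trans N≤ (maxCycles≤3 (s≤s e+s≤7))))
    e+[s′+s]≤7 IH
  where
  w = 𝟙 ∘ S
  e = w zero
  s′ = ∑[ r < 8 ] w (left (suc r))
  s = ∑[ z < k * 8 ] w (right (suc z))
  size≡ : ∑[ i < 8 + k * 8 ] w (suc i) ≡ s′ + s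
  size≡ = ∑-++ 8 (w ∘ suc)
  e+[s′+s]≤7 : e + (s′ + s) ≤ 7
  e+[s′+s]≤7 = subst (λ x → e + x ≤ 7) size≡ ≤7
  e+s≤7 : e + s ≤ 7
  e+s≤7 = ≤-trans (+-monoʳ-≤ e (m≤n+m s s′)) e+[s′+s]≤7
  s≤7 : s ≤ 7
  s≤7 = ≤-trans (m≤n+m s e) e+s≤7
  IH = system-bounded k (S ∘ right) e+s≤7
  P≤ = proj₁ IH
  N≤ = proj₁ (proj₂ IH)
  cycles≡ = trans (Σₗ-system k (inCycle w)) $
    cong (λ t → Σₗ (inCycle (w ∘ left)) system₉ + (Σₗ (inCycle (w ∘ right)) (system k) + t)) $
    Σₗ-cartesianProductWith (inCycle w) (inPair (w ∘ left ∘ suc)) (inPair (w ∘ right ∘ suc)) cross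
      (λ _ _ → refl) upper (lowers k)

-- From configurations to cycles inside their union

∣p∣≡∑ : (p : Subset n) → ∣ p ∣ ≡ ∑[ x < n ] 𝟙 (Vec.lookup p x)
∣p∣≡∑ Vec.[]            = refl
∣p∣≡∑ (true  Vec.∷ p)   = cong suc (∣p∣≡∑ p)
∣p∣≡∑ (false Vec.∷ p)   = ∣p∣≡∑ p

p∈ps⇒p⊆⋃ps : {p : Subset n} {ps : List (Subset n)} → p ∈ₗ ps → p ⊆ ⋃ ps
p∈ps⇒p⊆⋃ps (here refl)  x∈p = Subset.x∈p∪q⁺ (inj₁ x∈p)
p∈ps⇒p⊆⋃ps (there p∈ps) x∈p = Subset.x∈p∪q⁺ (inj₂ (p∈ps⇒p⊆⋃ps p∈ps x∈p))

corner∈vertices : (C : Cycle4 v) (i : Fin 4) → corner C i ∈ vertices C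
corner∈vertices C 0F = Subset.x∈p∪q⁺ (inj₁ (Subset.x∈⁅x⁆ _))
corner∈vertices C 1F = Subset.x∈p∪q⁺ (inj₂ (Subset.x∈p∪q⁺ (inj₁ (Subset.x∈⁅x⁆ _))))
corner∈vertices C 2F = Subset.x∈p∪q⁺ (inj₂ (Subset.x∈p∪q⁺ (inj₂ (Subset.x∈p∪q⁺ (inj₁ (Subset.x∈⁅x⁆ _))))))
corner∈vertices C 3F = Subset.x∈p∪q⁺ (inj₂ (Subset.x∈p∪q⁺ (inj₂ (Subset.x∈p∪q⁺ (inj₂ (Subset.x∈⁅x⁆ _))))))

vertices⊆⇒inCycle≡1 : (S : Subset v) (C : Cycle4 v) → vertices C ⊆ S → inCycle (𝟙 ∘ Vec.lookup S) C ≡ 1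
vertices⊆⇒inCycle≡1 S C C⊆S = cong₂ _*_ (cong₂ _*_ (weight 0F) (weight 2F)) (cong₂ _*_ (weight 1F) (weight 3F))
  where
  weight : ∀ i → 𝟙 (Vec.lookup S (corner C i)) ≡ 1
  weight i = cong 𝟙 (Vec.[]=⇒lookup (C⊆S (corner∈vertices C i)))

Σₗ-δ-∉ : ∀ {i : Fin n} {is} → All (i ≢_) is → Σₗ (δ i) is ≡ 0
Σₗ-δ-∉ []           = refl
Σₗ-δ-∉ (i≢j ∷ i∉is) = cong₂ _+_ (δ-≢ i≢j) (Σₗ-δ-∉ i∉is)

-- The left side is the multiplicity of `i` in `is`: at most 1, and nonzero only for members, where
-- `g` is positive.
Unique⇒Σₗ-δ≤ : (g : Fin n → ℕ) {is : List (Fin n)} → Unique is → All (λ i → 1 ≤ g i) is →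
  ∀ i → Σₗ (δ i) is ≤ g i
Unique⇒Σₗ-δ≤ g []          []         i = z≤n
Unique⇒Σₗ-δ≤ g {j ∷ is} (j∉is ∷ uniq) (1≤gj ∷ 1≤g) i with δ≡0⊎≡ i j
... | inj₁ δij≡0 = subst (λ d → d + Σₗ (δ i) is ≤ g i) (sym δij≡0) (Unique⇒Σₗ-δ≤ g uniq 1≤g i)
... | inj₂ refl  = subst (_≤ g i) (sym (cong₂ _+_ (δ-refl i) (Σₗ-δ-∉ j∉is))) 1≤gj

Unique⇒length≤∑ : (g : Fin n → ℕ) {is : List (Fin n)} → Unique is → All (λ i → 1 ≤ g i) is →
  length is ≤ ∑[ i < n ] g i
Unique⇒length≤∑ {n} g {is} uniq 1≤g = begin
  length is                             ≡⟨ *-identityʳ (length is) ⟨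
  length is * 1                         ≡⟨ Σₗ-const 1 is ⟨
  Σₗ (λ _ → 1) is                       ≡⟨ Σₗ-cong ∑-δ is ⟨
  Σₗ (λ j → ∑[ i < n ] δ i j) is        ≡⟨ ∑-Σₗ-comm δ is ⟨
  ∑[ i < n ] Σₗ (δ i) is                ≤⟨ ∑-mono-≤ (Unique⇒Σₗ-δ≤ g uniq 1≤g) ⟩
  ∑[ i < n ] g i                        ∎
  where open ≤-Reasoning

-- Each chosen cycle lies in the union `S` and so contributes 1 to the right side; distinct indices
-- contribute separately.
config≤ : (𝒞 : List (Cycle4 v)) {is : List (Fin (length 𝒞))} → Unique is →
  let S = ⋃ (map (λ i → vertices (lookup 𝒞 i)) is) in
  length is ≤ Σₗ (inCycle (𝟙 ∘ Vec.lookup S)) 𝒞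
config≤ 𝒞 {is} uniq = subst (length is ≤_) (∑-lookup (inCycle w) 𝒞) $
  Unique⇒length≤∑ (λ i → inCycle w (lookup 𝒞 i)) uniq $ All.tabulate λ {i} i∈is →
    ≤-reflexive $ sym $ vertices⊆⇒inCycle≡1 S (lookup 𝒞 i) $
    p∈ps⇒p⊆⋃ps (∈-map⁺ (λ i → vertices (lookup 𝒞 i)) i∈is)
  where
  S = ⋃ (map (λ i → vertices (lookup 𝒞 i)) is)
  w = 𝟙 ∘ Vec.lookup S

system-configs : ∀ k c l → c ≤ 7 → HasConfig (system k) c l → l ≤ maxCycles c
system-configs k _ _ c≤7 (is , uniq , refl , refl) =
  ≤-trans (config≤ (system k) uniq) $
  subst (λ c → Σₗ (inCycle (𝟙 ∘ Vec.lookup S)) (system k) ≤ maxCycles c) (sym (∣p∣≡∑ S)) $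
  proj₁ $ proj₂ $ system-bounded k (Vec.lookup S) $ subst (_≤ 7) (∣p∣≡∑ S) c≤7
  where S = ⋃ (map (λ i → vertices (lookup (system k) i)) is)

-- For `j` = 2, 3, 4 the bound `maxCycles (j + 3)` is 1, 2, 3, one less than `j`.
system-sparse : ∀ k → Sparse 4 (system k)
system-sparse k 0 ()
system-sparse k 1 (s≤s ())
system-sparse k 2 _ _ config = contradiction (system-configs k 5 2 (from-yes (5 ≤? 7)) config) (from-no (2 ≤? 1))
system-sparse k 3 _ _ config = contradiction (system-configs k 6 3 (from-yes (6 ≤? 7)) config) (from-no (3 ≤? 2))
system-sparse k 4 _ _ config = contradiction (system-configs k 7 4 (from-yes (7 ≤? 7)) config) (from-no (4 ≤? 3))
system-sparse k (suc (suc (suc (suc (suc _))))) _ (s≤s (s≤s (s≤s (s≤s ()))))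

theorem4 : (v : ℕ) → 1 ≤ v →
    (Σ (List (Cycle4 v)) (λ 𝒞 → Is4CS v 𝒞 × Sparse 4 𝒞)) ⇔ (v % 8 ≡ 1)
theorem4 v 1≤v = mk⇔
  (λ (𝒞 , is4cs , _) → CoversOnce⇒v%8≡1 𝒞 1≤v (Is4CS⇒CoversOnce 𝒞 is4cs))
  (λ v%8≡1 → subst (λ v → Σ (List (Cycle4 v)) (λ 𝒞 → Is4CS v 𝒞 × Sparse 4 𝒞))
    -- Division with remainder gives `v ≡ 1 + v / 8 * 8`, hence `v / 8` blocks.
    (sym (trans (m≡m%n+[m/n]*n v 8) (cong (_+ v / 8 * 8) v%8≡1)))
    (system (v / 8) , CoversOnce⇒Is4CS (system (v / 8)) (system-once (v / 8)) , system-sparse (v / 8)))
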